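{- Let $k \geq 1$ and $m \geq 1$ be integers with $m \not\equiv 0 \bmod 5$, and let $n = 5^k m$. Then the polynomials $F_{5^k m}(q)$ and $G_{5^k m}(q)$ are both divisible by $[5^k]_{q^m}$ (in $\mathbb{Z}[q]$).
   Context: For an indeterminate $q$ and an integer $n\ge 0$ let $[n]_q = \frac{1-q^n}{1-q} = 1+q+\cdots+q^{n-1}$; correspondingly $[n]_{q^m} = \frac{1-q^{nm}}{1-q^m} = 1 + q^m + \cdots + q^{(n-1)m}$. Let $\begin{bmatrix} n \\ k \end{bmatrix} = \frac{[n]_q [n-1]_q\cdots[n-k+1]_q}{[1]_q[2]_q\cdots[k]_q}$ be the $q$-binomial coefficient (a polynomial in $q$ with integer coefficients). The Schur-Carlitz $q$-Fibonacci numbers are the polynomials in $\mathbb{Z}[q]$ $$F_n(q) = \sum_{k=0}^{\lfloor (n-1)/2 \rfloor} q^{k^2} \begin{bmatrix} n-1-k \\ k \end{bmatrix}, \qquad G_n(q) = \sum_{k=0}^{\lfloor (n-1)/2 \rfloor} q^{k^2+k} \begin{bmatrix} n-1-k \\ k \end{bmatrix}.$$ Equivalently, $F_0(q)=0$, $F_1(q)=1$, $F_n(q)=F_{n-1}(q)+q^{n-2}F_{n-2}(q)$ and $G_0(q)=0$, $G_1(q)=1$, $G_n(q)=G_{n-1}(q)+q^{n-1}G_{n-2}(q)$ for $n\ge 2$. -}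

module Defs where

open import Algebra.Bundles using (CommutativeRing; Semiring)
import Algebra.Definitions.RawMagma
import Algebra.Properties.Monoid.Sum as MonoidSum
import Algebra.Properties.Semiring.Sum as SemiringSum
open import Data.Fin.Base using (Fin; toℕ)
open import Data.Fin.Properties using (toℕ-inject₁; toℕ-fromℕ)
open import Data.Integer.Base as ℤ using (ℤ; 0ℤ; 1ℤ)
import Data.Integer.Properties as ℤ
open import Data.List.Base using (List; []; _∷_; map)
open import Data.Nat.Base as ℕ using (ℕ; zero; suc; _∸_; ⌈_/2⌉; s≤s)
import Data.Nat.Properties as ℕ
open import Data.Product.Base using (_,_)
open import Level using (0ℓ)
open import Relation.Binary.Bundles using (Setoid)
open import Relation.Binary.PropositionalEquality as ≡ using (_≡_; cong; cong₂)
import Relation.Binary.Reasoning.Setoid as SetoidReasoning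
open import Relation.Nullary.Decidable using (yes; no)

------------------------------------------------------------------------
-- The ring ℤ[q]

-- Coefficients in increasing degree; trailing zeros are allowed, so
-- polynomials are compared by _≈ₚ_ rather than by _≡_.
Poly : Set
Poly = List ℤ

coeff : Poly → ℕ → ℤ
coeff []      _       = 0ℤ
coeff (a ∷ _) zero    = a
coeff (_ ∷ p) (suc i) = coeff p i

infix 4 _≈ₚ_
record _≈ₚ_ (p r : Poly) : Set where
  constructor coeffs
  field at : ∀ i → coeff p i ≡ coeff r i
open _≈ₚ_

infixl 6 _+ₚ_
infixl 7 _*ₚ_ _·_

_+ₚ_ : Poly → Poly → Poly
[]      +ₚ r       = r
(a ∷ p) +ₚ []      = a ∷ p
(a ∷ p) +ₚ (b ∷ r) = (a ℤ.+ b) ∷ (p +ₚ r)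

_·_ : ℤ → Poly → Poly
c · p = map (c ℤ.*_) p

-ₚ_ : Poly → Poly
-ₚ p = map ℤ.-_ p

_*ₚ_ : Poly → Poly → Poly
[]      *ₚ r = []
(a ∷ p) *ₚ r = a · r +ₚ (0ℤ ∷ p *ₚ r)

0ₚ 1ₚ q : Poly
0ₚ = []
1ₚ = 1ℤ ∷ []
q  = 0ℤ ∷ 1ℤ ∷ []

private
  setoidₚ : Setoid 0ℓ 0ℓ
  setoidₚ = record
    { Carrier = Poly ; _≈_ = _≈ₚ_
    ; isEquivalence = record
      { refl  = coeffs λ _ → ≡.refl
      ; sym   = λ e → coeffs λ i → ≡.sym (at e i)
      ; trans = λ e f → coeffs λ i → ≡.trans (at e i) (at f i)
      }
    }

  open Setoid setoidₚ using (refl; sym; trans)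

  coeff-+ : ∀ p r i → coeff (p +ₚ r) i ≡ coeff p i ℤ.+ coeff r i
  coeff-+ []      r       i       = ≡.sym (ℤ.+-identityˡ _)
  coeff-+ (a ∷ p) []      i       = ≡.sym (ℤ.+-identityʳ _)
  coeff-+ (a ∷ p) (b ∷ r) zero    = ≡.refl
  coeff-+ (a ∷ p) (b ∷ r) (suc i) = coeff-+ p r i

  coeff-· : ∀ c p i → coeff (c · p) i ≡ c ℤ.* coeff p i
  coeff-· c []      i       = ≡.sym (ℤ.*-zeroʳ c)
  coeff-· c (a ∷ p) zero    = ≡.refl
  coeff-· c (a ∷ p) (suc i) = coeff-· c p i

  coeff-neg : ∀ p i → coeff (-ₚ p) i ≡ ℤ.- coeff p i
  coeff-neg []      i       = ≡.refl
  coeff-neg (a ∷ p) zero    = ≡.refl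
  coeff-neg (a ∷ p) (suc i) = coeff-neg p i

  ∷-cong : ∀ {a b p r} → a ≡ b → p ≈ₚ r → a ∷ p ≈ₚ b ∷ r
  ∷-cong a≡b e = coeffs λ { zero → a≡b ; (suc i) → at e i }

  0∷0 : 0ℤ ∷ [] ≈ₚ []
  0∷0 = coeffs λ { zero → ≡.refl ; (suc i) → ≡.refl }

  +-cong : ∀ {p p′ r r′} → p ≈ₚ p′ → r ≈ₚ r′ → p +ₚ r ≈ₚ p′ +ₚ r′
  +-cong {p} {p′} {r} {r′} e f = coeffs λ i →
    ≡.trans (coeff-+ p r i)
      (≡.trans (cong₂ ℤ._+_ (at e i) (at f i)) (≡.sym (coeff-+ p′ r′ i)))

  +-comm : ∀ p r → p +ₚ r ≈ₚ r +ₚ p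
  +-comm p r = coeffs λ i →
    ≡.trans (coeff-+ p r i)
      (≡.trans (ℤ.+-comm (coeff p i) (coeff r i)) (≡.sym (coeff-+ r p i)))

  +-assoc : ∀ p r s → (p +ₚ r) +ₚ s ≈ₚ p +ₚ (r +ₚ s)
  +-assoc p r s = coeffs λ i → begin
    coeff ((p +ₚ r) +ₚ s) i                    ≡⟨ coeff-+ (p +ₚ r) s i ⟩
    coeff (p +ₚ r) i ℤ.+ coeff s i             ≡⟨ cong (ℤ._+ coeff s i) (coeff-+ p r i) ⟩
    coeff p i ℤ.+ coeff r i ℤ.+ coeff s i      ≡⟨ ℤ.+-assoc (coeff p i) _ _ ⟩
    coeff p i ℤ.+ (coeff r i ℤ.+ coeff s i)    ≡⟨ cong (λ z → coeff p i ℤ.+ z) (coeff-+ r s i) ⟨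
    coeff p i ℤ.+ coeff (r +ₚ s) i             ≡⟨ coeff-+ p (r +ₚ s) i ⟨
    coeff (p +ₚ (r +ₚ s)) i                    ∎
    where open ≡.≡-Reasoning

  +-identityʳ : ∀ p → p +ₚ [] ≈ₚ p
  +-identityʳ p = +-comm p []

  -‿inverseˡ : ∀ p → (-ₚ p) +ₚ p ≈ₚ []
  -‿inverseˡ p = coeffs λ i →
    ≡.trans (coeff-+ (-ₚ p) p i)
      (≡.trans (cong (ℤ._+ coeff p i) (coeff-neg p i)) (ℤ.+-inverseˡ (coeff p i)))

  -‿inverseʳ : ∀ p → p +ₚ (-ₚ p) ≈ₚ []
  -‿inverseʳ p = trans (+-comm p (-ₚ p)) (-‿inverseˡ p)

  -‿cong : ∀ {p r} → p ≈ₚ r → -ₚ p ≈ₚ -ₚ r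
  -‿cong {p} {r} e = coeffs λ i →
    ≡.trans (coeff-neg p i) (≡.trans (cong ℤ.-_ (at e i)) (≡.sym (coeff-neg r i)))

  open SetoidReasoning setoidₚ

  interchange : ∀ a b c d → (a +ₚ b) +ₚ (c +ₚ d) ≈ₚ (a +ₚ c) +ₚ (b +ₚ d)
  interchange a b c d = begin
    (a +ₚ b) +ₚ (c +ₚ d) ≈⟨ +-assoc a b (c +ₚ d) ⟩
    a +ₚ (b +ₚ (c +ₚ d)) ≈⟨ +-cong (refl {a}) (+-assoc b c d) ⟨
    a +ₚ ((b +ₚ c) +ₚ d) ≈⟨ +-cong (refl {a}) (+-cong (+-comm b c) (refl {d})) ⟩
    a +ₚ ((c +ₚ b) +ₚ d) ≈⟨ +-cong (refl {a}) (+-assoc c b d) ⟩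
    a +ₚ (c +ₚ (b +ₚ d)) ≈⟨ +-assoc a c (b +ₚ d) ⟨
    (a +ₚ c) +ₚ (b +ₚ d) ∎

  ·-cong : ∀ c {p r} → p ≈ₚ r → c · p ≈ₚ c · r
  ·-cong c {p} {r} e = coeffs λ i →
    ≡.trans (coeff-· c p i) (≡.trans (cong (c ℤ.*_) (at e i)) (≡.sym (coeff-· c r i)))

  ·-distribˡ : ∀ c p r → c · (p +ₚ r) ≈ₚ c · p +ₚ c · r
  ·-distribˡ c []      r       = refl
  ·-distribˡ c (a ∷ p) []      = refl
  ·-distribˡ c (a ∷ p) (b ∷ r) = ∷-cong (ℤ.*-distribˡ-+ c a b) (·-distribˡ c p r)

  ·-assoc : ∀ c d p → (c ℤ.* d) · p ≈ₚ c · (d · p)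
  ·-assoc c d []      = refl
  ·-assoc c d (a ∷ p) = ∷-cong (ℤ.*-assoc c d a) (·-assoc c d p)

  1· : ∀ p → 1ℤ · p ≈ₚ p
  1· []      = refl
  1· (a ∷ p) = ∷-cong (ℤ.*-identityˡ a) (1· p)

  0· : ∀ p → 0ℤ · p ≈ₚ []
  0· p = coeffs λ i → ≡.trans (coeff-· 0ℤ p i) (ℤ.*-zeroˡ (coeff p i))

  *-zeroʳ : ∀ p → p *ₚ [] ≈ₚ []
  *-zeroʳ []      = refl
  *-zeroʳ (a ∷ p) = trans (∷-cong ≡.refl (*-zeroʳ p)) 0∷0

  *-congˡ : ∀ p {r s} → r ≈ₚ s → p *ₚ r ≈ₚ p *ₚ s
  *-congˡ []      e = refl
  *-congˡ (a ∷ p) e = +-cong (·-cong a e) (∷-cong ≡.refl (*-congˡ p e))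

  *-distribˡ : ∀ p r s → p *ₚ (r +ₚ s) ≈ₚ p *ₚ r +ₚ p *ₚ s
  *-distribˡ []      r s = refl
  *-distribˡ (a ∷ p) r s = begin
    a · (r +ₚ s) +ₚ (0ℤ ∷ p *ₚ (r +ₚ s))
      ≈⟨ +-cong (·-distribˡ a r s) (∷-cong ≡.refl (*-distribˡ p r s)) ⟩
    (a · r +ₚ a · s) +ₚ ((0ℤ ∷ p *ₚ r) +ₚ (0ℤ ∷ p *ₚ s))
      ≈⟨ interchange (a · r) (a · s) (0ℤ ∷ p *ₚ r) (0ℤ ∷ p *ₚ s) ⟩
    (a ∷ p) *ₚ r +ₚ (a ∷ p) *ₚ s ∎

  *-∷ʳ : ∀ p b r → p *ₚ (b ∷ r) ≈ₚ b · p +ₚ (0ℤ ∷ p *ₚ r)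
  *-∷ʳ []      b r = sym 0∷0
  *-∷ʳ (a ∷ p) b r = ∷-cong (cong (ℤ._+ 0ℤ) (ℤ.*-comm a b)) (begin
    a · r +ₚ p *ₚ (b ∷ r)               ≈⟨ +-cong (refl {a · r}) (*-∷ʳ p b r) ⟩
    a · r +ₚ (b · p +ₚ (0ℤ ∷ p *ₚ r))   ≈⟨ +-assoc (a · r) (b · p) _ ⟨
    (a · r +ₚ b · p) +ₚ (0ℤ ∷ p *ₚ r)   ≈⟨ +-cong (+-comm (a · r) (b · p)) refl ⟩
    (b · p +ₚ a · r) +ₚ (0ℤ ∷ p *ₚ r)   ≈⟨ +-assoc (b · p) (a · r) _ ⟩
    b · p +ₚ (a · r +ₚ (0ℤ ∷ p *ₚ r))   ∎)

  *-comm : ∀ p r → p *ₚ r ≈ₚ r *ₚ p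
  *-comm []      r = sym (*-zeroʳ r)
  *-comm (a ∷ p) r = begin
    a · r +ₚ (0ℤ ∷ p *ₚ r) ≈⟨ +-cong (refl {a · r}) (∷-cong ≡.refl (*-comm p r)) ⟩
    a · r +ₚ (0ℤ ∷ r *ₚ p) ≈⟨ *-∷ʳ r a p ⟨
    r *ₚ (a ∷ p)           ∎

  *-cong : ∀ {p p′ r r′} → p ≈ₚ p′ → r ≈ₚ r′ → p *ₚ r ≈ₚ p′ *ₚ r′
  *-cong {p} {p′} {r} {r′} e f = begin
    p *ₚ r   ≈⟨ *-congˡ p f ⟩
    p *ₚ r′  ≈⟨ *-comm p r′ ⟩
    r′ *ₚ p  ≈⟨ *-congˡ r′ e ⟩
    r′ *ₚ p′ ≈⟨ *-comm r′ p′ ⟩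
    p′ *ₚ r′ ∎

  *-distribʳ : ∀ p r s → (r +ₚ s) *ₚ p ≈ₚ r *ₚ p +ₚ s *ₚ p
  *-distribʳ p r s = begin
    (r +ₚ s) *ₚ p     ≈⟨ *-comm (r +ₚ s) p ⟩
    p *ₚ (r +ₚ s)     ≈⟨ *-distribˡ p r s ⟩
    p *ₚ r +ₚ p *ₚ s  ≈⟨ +-cong (*-comm p r) (*-comm p s) ⟩
    r *ₚ p +ₚ s *ₚ p  ∎

  ·-*-assoc : ∀ c p r → (c · p) *ₚ r ≈ₚ c · (p *ₚ r)
  ·-*-assoc c []      r = refl
  ·-*-assoc c (a ∷ p) r = begin
    (c ℤ.* a) · r +ₚ (0ℤ ∷ (c · p) *ₚ r)
      ≈⟨ +-cong (·-assoc c a r) (∷-cong (≡.sym (ℤ.*-zeroʳ c)) (·-*-assoc c p r)) ⟩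
    c · (a · r) +ₚ c · (0ℤ ∷ p *ₚ r)
      ≈⟨ ·-distribˡ c (a · r) (0ℤ ∷ p *ₚ r) ⟨
    c · (a · r +ₚ (0ℤ ∷ p *ₚ r)) ∎

  *-assoc : ∀ p r s → (p *ₚ r) *ₚ s ≈ₚ p *ₚ (r *ₚ s)
  *-assoc []      r s = refl
  *-assoc (a ∷ p) r s = begin
    (a · r +ₚ (0ℤ ∷ p *ₚ r)) *ₚ s
      ≈⟨ *-distribʳ s (a · r) (0ℤ ∷ p *ₚ r) ⟩
    (a · r) *ₚ s +ₚ (0ℤ · s +ₚ (0ℤ ∷ (p *ₚ r) *ₚ s))
      ≈⟨ +-cong (·-*-assoc a r s) (+-cong (0· s) (∷-cong ≡.refl (*-assoc p r s))) ⟩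
    a · (r *ₚ s) +ₚ (0ℤ ∷ p *ₚ (r *ₚ s)) ∎

  *-identityˡ : ∀ p → 1ₚ *ₚ p ≈ₚ p
  *-identityˡ p = begin
    1ℤ · p +ₚ (0ℤ ∷ []) ≈⟨ +-cong (1· p) 0∷0 ⟩
    p +ₚ []             ≈⟨ +-identityʳ p ⟩
    p                   ∎

ℤ[q] : CommutativeRing 0ℓ 0ℓ
ℤ[q] = record
  { Carrier = Poly ; _≈_ = _≈ₚ_
  ; _+_ = _+ₚ_ ; _*_ = _*ₚ_ ; -_ = -ₚ_ ; 0# = 0ₚ ; 1# = 1ₚ
  ; isCommutativeRing = record
    { isRing = record
      { +-isAbelianGroup = record
        { isGroup = record
          { isMonoid = record
            { isSemigroup = record
              { isMagma = record
                { isEquivalence = Setoid.isEquivalence setoidₚ ; ∙-cong = +-cong }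
              ; assoc = +-assoc
              }
            ; identity = (λ _ → refl) , +-identityʳ
            }
          ; inverse = -‿inverseˡ , -‿inverseʳ
          ; ⁻¹-cong = -‿cong
          }
        ; comm = +-comm
        }
      ; *-cong = *-cong
      ; *-assoc = *-assoc
      ; *-identity = *-identityˡ , λ p → trans (*-comm p 1ₚ) (*-identityˡ p)
      ; distrib = *-distribˡ , *-distribʳ
      }
    ; *-comm = *-comm
    }
  }

module R = CommutativeRing ℤ[q]
open R using (_+_; _*_)
open import Algebra.Definitions.RawSemiring (Semiring.rawSemiring R.semiring) public using (_^_; product; _∣_)
open MonoidSum R.+-monoid public using (sum-syntax)

------------------------------------------------------------------------
-- q-analogues

-- [ n ]⟨ x ⟩ = 1 + x + ⋯ + xⁿ⁻¹
[_]⟨_⟩ : ℕ → Poly → Poly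
[ n ]⟨ x ⟩ = ∑[ i < n ] (x ^ toℕ i)

-- [n]_q [n-1]_q ⋯ [n-k+1]_q.  For k > n the truncated subtraction is
-- harmless: the factor with i = n is already [0]_q = 0.
falling : ℕ → ℕ → Poly
falling n k = product λ (i : Fin k) → [ n ∸ toℕ i ]⟨ q ⟩

-- [1]_q [2]_q ⋯ [k]_q
factorial : ℕ → Poly
factorial k = product λ (i : Fin k) → [ suc (toℕ i) ]⟨ q ⟩

private
  module Σ = SemiringSum R.semiring
  module Π = MonoidSum R.*-monoid

[suc] : ∀ n x → [ suc n ]⟨ x ⟩ R.≈ 1ₚ + x * [ n ]⟨ x ⟩
[suc] n x = R.+-congˡ (R.sym (Σ.*-distribˡ-sum {n} x (λ i → x ^ toℕ i)))

[+] : ∀ a b x → [ a ℕ.+ b ]⟨ x ⟩ R.≈ [ a ]⟨ x ⟩ + x ^ a * [ b ]⟨ x ⟩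
[+] zero    b x = R.sym (R.*-identityˡ _)
[+] (suc a) b x = begin
  [ suc (a ℕ.+ b) ]⟨ x ⟩              ≈⟨ [suc] (a ℕ.+ b) x ⟩
  1ₚ + x * [ a ℕ.+ b ]⟨ x ⟩           ≈⟨ R.+-congˡ (R.*-congˡ {x} ([+] a b x)) ⟩
  1ₚ + x * (A + x ^ a * B)            ≈⟨ R.+-congˡ (R.distribˡ x A (x ^ a * B)) ⟩
  1ₚ + (x * A + x * (x ^ a * B))      ≈⟨ R.+-assoc 1ₚ (x * A) (x * (x ^ a * B)) ⟨
  1ₚ + x * A + x * (x ^ a * B)        ≈⟨ R.+-cong (R.sym ([suc] a x)) (R.sym (R.*-assoc x (x ^ a) B)) ⟩
  [ suc a ]⟨ x ⟩ + x ^ suc a * B      ∎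
  where A = [ a ]⟨ x ⟩ ; B = [ b ]⟨ x ⟩

product-snoc : ∀ (f : ℕ → Poly) k →
  product (λ (i : Fin (suc k)) → f (toℕ i)) R.≈ product (λ (i : Fin k) → f (toℕ i)) * f k
product-snoc f k = R.trans (Π.sum-init-last {k} (λ i → f (toℕ i)))
  (R.reflexive (cong₂ _*_ (Π.sum-cong-≗ {k} (λ i → cong f (toℕ-inject₁ i)))
                          (cong f (toℕ-fromℕ k))))

falling≈0 : ∀ {n k} → n ℕ.< k → falling n k R.≈ 0ₚ
falling≈0 {zero}  {suc k} _         = R.zeroˡ (product λ (i : Fin k) → [ 0 ∸ toℕ (Fin.suc i) ]⟨ q ⟩)
falling≈0 {suc n} {suc k} (s≤s n<k) =
  R.trans (R.*-congˡ {[ suc n ]⟨ q ⟩} (falling≈0 n<k)) (R.zeroʳ [ suc n ]⟨ q ⟩)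

-- q-Pascal, from
-- [n+1]_q = [k+1]_q + q^(k+1) [n-k]_q.
falling-pascal : ∀ n k → k ℕ.≤ n → falling (suc n) (suc k) R.≈
  [ suc k ]⟨ q ⟩ * falling n k + q ^ suc k * falling n (suc k)
falling-pascal n k k≤n = begin
  [ suc n ]⟨ q ⟩ * N
    ≡⟨ cong (λ j → [ suc j ]⟨ q ⟩ * N) (ℕ.m+[n∸m]≡n k≤n) ⟨
  [ suc k ℕ.+ (n ∸ k) ]⟨ q ⟩ * N
    ≈⟨ R.*-congʳ {N} ([+] (suc k) (n ∸ k) q) ⟩
  (K + Q * D) * N
    ≈⟨ R.distribʳ N K (Q * D) ⟩
  K * N + Q * D * N
    ≈⟨ R.+-congˡ {K * N} (R.*-assoc Q D N) ⟩
  K * N + Q * (D * N)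
    ≈⟨ R.+-congˡ {K * N} (R.*-congˡ {Q} (R.*-comm D N)) ⟩
  K * N + Q * (N * D)
    ≈⟨ R.+-congˡ {K * N} (R.*-congˡ {Q} (product-snoc (λ i → [ n ∸ i ]⟨ q ⟩) k)) ⟨
  K * N + Q * falling n (suc k) ∎
  where
  N = falling n k ; K = [ suc k ]⟨ q ⟩ ; Q = q ^ suc k ; D = [ n ∸ k ]⟨ q ⟩

factorial∣falling : ∀ n k → factorial k ∣ falling n k
factorial∣falling n       zero    = record { quotient = 1ₚ ; equality = R.*-identityˡ 1ₚ }
factorial∣falling zero    (suc k) = record
  { quotient = 0ₚ
  ; equality = R.sym (falling≈0 {zero} {suc k} (s≤s ℕ.z≤n))
  }
factorial∣falling (suc n) (suc k) with k ℕ.≤? n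
... | no k≰n = record
  { quotient = 0ₚ
  ; equality = R.sym (falling≈0 {suc n} {suc k} (s≤s (ℕ.≰⇒> k≰n)))
  }
... | yes k≤n with factorial∣falling n k | factorial∣falling n (suc k)
...   | record { quotient = u ; equality = uk≈ } | record { quotient = v ; equality = vk≈ } = record
  { quotient = u + Q * v
  ; equality = begin
      (u + Q * v) * factorial (suc k)
        ≈⟨ R.distribʳ (factorial (suc k)) u (Q * v) ⟩
      u * factorial (suc k) + Q * v * factorial (suc k)
        ≈⟨ R.+-cong (R.*-congˡ {u} (product-snoc (λ i → [ suc i ]⟨ q ⟩) k))
                    (R.*-assoc Q v (factorial (suc k))) ⟩
      u * (factorial k * K) + Q * (v * factorial (suc k))
        ≈⟨ R.+-cong (R.sym (R.*-assoc u (factorial k) K)) (R.*-congˡ {Q} vk≈) ⟩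
      u * factorial k * K + Q * falling n (suc k)
        ≈⟨ R.+-congʳ (R.trans (R.*-congʳ {K} uk≈) (R.*-comm (falling n k) K)) ⟩
      K * falling n k + Q * falling n (suc k)
        ≈⟨ falling-pascal n k k≤n ⟨
      falling (suc n) (suc k) ∎
  }
  where
  K = [ suc k ]⟨ q ⟩ ; Q = q ^ suc k

-- The exact quotient falling n k / factorial k.  It is determined up
-- to _≈ₚ_, since factorial k has constant term 1.
qbinomial : ℕ → ℕ → Poly
qbinomial n k = quotient where open Algebra.Definitions.RawMagma._∣ʳ_ (factorial∣falling n k)

------------------------------------------------------------------------
-- Schur–Carlitz q-Fibonacci numbers

-- The range 0 ≤ k ≤ ⌊(n-1)/2⌋ is k < ⌈n/2⌉, which is empty for n = 0.
-- On it both subtractions are exact.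
F G : ℕ → Poly
F n = ∑[ k < ⌈ n /2⌉ ] (q ^ (toℕ k ℕ.* toℕ k) * qbinomial (n ∸ 1 ∸ toℕ k) (toℕ k))
G n = ∑[ k < ⌈ n /2⌉ ] (q ^ (toℕ k ℕ.* toℕ k ℕ.+ toℕ k) * qbinomial (n ∸ 1 ∸ toℕ k) (toℕ k))

{-# OPTIONS --safe #-}

-- Write n = 5^k m, and [n; r] for the Gaussian binomial.  Variants of Schur's finite
-- Rogers-Ramanujan identities express F_n and G_n as sums of w(n - 2r) [n; r] over r,
-- where the weight w is supported away from the multiples of 5; since 5 divides n, only
-- r prime to 5 contribute.  For such r, Bézout's identity for 5^k and r writes [m] as a
-- combination of [r] and [n], and [r] [n; r] = [n] [n-1; r-1], so [n] = [5^k]_{q^m} [m]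
-- divides [m] [n; r]; finally [m] can be cancelled because its constant term is 1.

module Submission where

open import Defs using (F; G; q; [_]⟨_⟩; _∣_) renaming (_^_ to _^ₚ_)
open import Data.Nat using (ℕ; _≤_; _*_; _^_; _%_)
open import Data.Product using (_×_)
open import Relation.Binary.PropositionalEquality using (_≢_)

open import Algebra.Bundles using (CommutativeRing; Semiring)
open import Data.Fin.Base using (toℕ)
open import Data.Integer.Base as ℤ using (0ℤ; 1ℤ)
import Data.Integer.Properties as ℤ
open import Data.List.Base using ([]; _∷_)
open import Data.Nat.Base as ℕ using (zero; suc; _∸_; ⌈_/2⌉; ⌊_/2⌋; z≤n; s≤s)
open import Data.Nat.Coprimality using (Coprime; 1-coprimeTo; coprime-Bézout; coprime-divisor)
open import Data.Nat.Divisibility using (divides; m∣m*n; ∣-trans; ∣m+n∣m⇒∣n; _∣?_) renaming (_∣_ to _∣ℕ_)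
open import Data.Nat.GCD using (module Bézout)
open import Data.Nat.Primality using (Prime; prime?; prime⇒irreducible)
import Data.Nat.Properties as ℕ
open import Data.Nat.Solver using (module +-*-Solver)
open import Data.Product using (∃₂; _,_; proj₁; proj₂)
open import Data.Sum using (_⊎_; inj₁; inj₂)
open import Defs using (Poly; coeff; coeffs; _≈ₚ_; _+ₚ_; _·_; _*ₚ_; 0ₚ; 1ₚ; -ₚ_; ℤ[q]; module R; [suc]; [+]; qbinomial)
open import Level using (0ℓ)
open import Relation.Binary.PropositionalEquality as ≡ using (_≡_)
open import Relation.Nullary using (¬_; yes; no; contradiction)
open import Relation.Nullary.Decidable using (from-yes)

open _≈ₚ_ using (at)
private module ℕS = +-*-Solver

-- Sums weighted by Gaussian binomials

module Weighted (R : CommutativeRing 0ℓ 0ℓ) (q : CommutativeRing.Carrier R) where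

  open CommutativeRing R renaming (_*_ to _∙_)
  open import Algebra.Definitions.RawSemiring (Semiring.rawSemiring semiring) using () renaming (_^_ to _^ᴿ_)
  open import Algebra.Properties.Ring ring using (-0#≈0#)
  open import Algebra.Properties.Semiring.Exp semiring using (^-congʳ; ^-homo-*)
  open import Algebra.Solver.Ring.NaturalCoefficients.Default commutativeSemiring
  open import Relation.Binary.Reasoning.Setoid setoid

  Weight : Set
  Weight = ℕ → ℕ → Carrier

  infixl 6 _⊕_
  infixr 7 _⊙_ _⊛_

  _⊕_ : Weight → Weight → Weight
  (w ⊕ v) r s = w r s + v r s

  _⊙_ : Carrier → Weight → Weight
  (c ⊙ w) r s = c ∙ w r s

  _⊛_ : (ℕ → Carrier) → Weight → Weight
  (f ⊛ w) r s = f r ∙ w r s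

  shift : Weight → Weight
  shift w r s = w (suc r) s

  -- The two q-Pascal rules, transposed so that they act on the weight instead of on the binomial.
  pascal pascal′ : Weight → Weight
  pascal  w r s = w (suc r) s + q ^ᴿ r ∙ w r (suc s)
  pascal′ w r s = q ^ᴿ s ∙ w (suc r) s + w r (suc s)

  -- T n w is the sum of w r s times the Gaussian binomial [n; r] over r + s = n;
  -- q-Pascal is built into the recursion, so the binomials never appear.
  T : ℕ → Weight → Carrier
  T zero    w = w 0 0
  T (suc n) w = T n (pascal w)

  T-cong : ∀ n {w v} → (∀ r s → r ℕ.+ s ≡ n → w r s ≈ v r s) → T n w ≈ T n v
  T-cong zero    w≈v = w≈v 0 0 ≡.refl
  T-cong (suc n) w≈v = T-cong n λ r s r+s≡n →
    +-cong (w≈v (suc r) s (≡.cong suc r+s≡n))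
           (*-congˡ (w≈v r (suc s) (≡.trans (ℕ.+-suc r s) (≡.cong suc r+s≡n))))

  T-⊕ : ∀ n w v → T n (w ⊕ v) ≈ T n w + T n v
  T-⊕ zero    w v = refl
  T-⊕ (suc n) w v = begin
    T n (pascal (w ⊕ v))          ≈⟨ T-cong n (λ r s _ → solve 5 (λ Q a b c d →
      (a :+ b) :+ Q :* (c :+ d) := (a :+ Q :* c) :+ (b :+ Q :* d)) refl
      (q ^ᴿ r) (w (suc r) s) (v (suc r) s) (w r (suc s)) (v r (suc s))) ⟩
    T n (pascal w ⊕ pascal v)     ≈⟨ T-⊕ n (pascal w) (pascal v) ⟩
    T n (pascal w) + T n (pascal v) ∎

  T-⊙ : ∀ n c w → T n (c ⊙ w) ≈ c ∙ T n w
  T-⊙ zero    c w = refl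
  T-⊙ (suc n) c w = begin
    T n (pascal (c ⊙ w)) ≈⟨ T-cong n (λ r s _ → solve 4 (λ Q c a b →
      c :* a :+ Q :* (c :* b) := c :* (a :+ Q :* b)) refl
      (q ^ᴿ r) c (w (suc r) s) (w r (suc s))) ⟩
    T n (c ⊙ pascal w)   ≈⟨ T-⊙ n c (pascal w) ⟩
    c ∙ T n (pascal w)   ∎

  pascal-comm : ∀ w r s → pascal′ (pascal w) r s ≈ pascal (pascal′ w) r s
  pascal-comm w r s = solve 6 (λ x Q P a b c →
      P :* (a :+ x :* Q :* b) :+ (b :+ Q :* c)
    := (P :* a :+ b) :+ Q :* (x :* P :* b :+ c)) refl
    q (q ^ᴿ r) (q ^ᴿ s) (w (suc (suc r)) s) (w (suc r) (suc s)) (w r (suc (suc s)))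

  -- `T` is built on the first q-Pascal rule. As operators on weights the two rules commute, so by
  -- induction the second can be peeled off instead.
  T-pascal′ : ∀ n w → T (suc n) w ≈ T n (pascal′ w)
  T-pascal′ zero    w = solve 2 (λ a b → a :+ con 1 :* b := con 1 :* a :+ b) refl (w 1 0) (w 0 1)
  T-pascal′ (suc n) w = begin
    T (suc n) (pascal w)    ≈⟨ T-pascal′ n (pascal w) ⟩
    T n (pascal′ (pascal w)) ≈⟨ T-cong n (λ r s _ → pascal-comm w r s) ⟩
    T n (pascal (pascal′ w)) ∎

  module _ (b : ℕ → Carrier) (b₀ : b 0 ≈ 0#) (bₛ : ∀ n → b (suc n) ≈ 1# + q ∙ b n) where

    -- The absorption identity [r] [n+1; r] = [n+1] [n; r-1].
    T-absorb : ∀ n w → T (suc n) (b ⊛ w) ≈ b (suc n) ∙ T n (shift w)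
    T-absorb zero    w = begin
      b 1 ∙ w 1 0 + 1# ∙ (b 0 ∙ w 0 1)  ≈⟨ +-congˡ (*-congˡ (*-congʳ b₀)) ⟩
      b 1 ∙ w 1 0 + 1# ∙ (0# ∙ w 0 1)   ≈⟨ solve 3 (λ a x y →
        a :* x :+ con 1 :* (con 0 :* y) := a :* x) refl (b 1) (w 1 0) (w 0 1) ⟩
      b 1 ∙ w 1 0                       ∎
    T-absorb (suc n) w = begin
      T (suc n) (pascal (b ⊛ w))
        ≈⟨ T-cong (suc n) (λ r s _ → trans (+-congʳ (*-congʳ (bₛ r)))
             (solve 5 (λ x Q β a c →
               (con 1 :+ x :* β) :* a :+ Q :* (β :* c) := a :+ β :* (x :* a :+ Q :* c)) refl
               q (q ^ᴿ r) (b r) (w (suc r) s) (w r (suc s)))) ⟩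
      -- Here `shift v` is `q ⊙ pascal (shift w)`, so the induction hypothesis for `v` leads back to
      -- the sum `T (suc n) (shift w)`.
      T (suc n) (shift w ⊕ b ⊛ v)
        ≈⟨ T-⊕ (suc n) (shift w) (b ⊛ v) ⟩
      T (suc n) (shift w) + T (suc n) (b ⊛ v)
        ≈⟨ +-congˡ (T-absorb n v) ⟩
      T (suc n) (shift w) + b (suc n) ∙ T n (shift v)
        ≈⟨ +-congˡ (*-congˡ (T-cong n (λ r s _ → solve 4 (λ x Q a c →
             x :* a :+ x :* Q :* c := x :* (a :+ Q :* c)) refl
             q (q ^ᴿ r) (w (suc (suc r)) s) (w (suc r) (suc s))))) ⟩
      T (suc n) (shift w) + b (suc n) ∙ T n (q ⊙ pascal (shift w))
        ≈⟨ +-congˡ (*-congˡ (T-⊙ n q (pascal (shift w)))) ⟩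
      T (suc n) (shift w) + b (suc n) ∙ (q ∙ T (suc n) (shift w))
        ≈⟨ solve 3 (λ t β x → t :+ β :* (x :* t) := (con 1 :+ x :* β) :* t) refl
             (T (suc n) (shift w)) (b (suc n)) q ⟩
      (1# + q ∙ b (suc n)) ∙ T (suc n) (shift w)
        ≈⟨ *-congʳ (bₛ (suc n)) ⟨
      b (suc (suc n)) ∙ T (suc n) (shift w) ∎
      where
      v : Weight
      v r s = q ∙ w (suc r) s + q ^ᴿ r ∙ w r (suc s)

    -- Absorption turns the part of `c` along [r] into a multiple of [n+1]. The hypothesis is
    -- multiplied by `w r s`, hence automatic wherever `w` vanishes.
    T-divisible : ∀ n c w (α β : ℕ → Carrier) →
      (∀ r s → r ℕ.+ s ≡ suc n → c ∙ w r s ≈ (α r ∙ b r + β r ∙ b (suc n)) ∙ w r s) →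
      c ∙ T (suc n) w ≈
      b (suc n) ∙ (T n (shift (α ⊛ w)) + T (suc n) (β ⊛ w))
    T-divisible n c w α β eq = begin
      c ∙ T (suc n) w  ≈⟨ T-⊙ (suc n) c w ⟨
      T (suc n) (c ⊙ w)
        ≈⟨ T-cong (suc n) (λ r s r+s≡n → trans (eq r s r+s≡n)
             (solve 5 (λ α r β n w → (α :* r :+ β :* n) :* w := r :* (α :* w) :+ n :* (β :* w)) refl
               (α r) (b r) (β r) (b (suc n)) (w r s))) ⟩
      T (suc n) (b ⊛ (α ⊛ w) ⊕ b (suc n) ⊙ (β ⊛ w))
        ≈⟨ T-⊕ (suc n) (b ⊛ (α ⊛ w)) (b (suc n) ⊙ (β ⊛ w)) ⟩
      T (suc n) (b ⊛ (α ⊛ w)) + T (suc n) (b (suc n) ⊙ (β ⊛ w))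
        ≈⟨ +-cong (T-absorb n (α ⊛ w)) (T-⊙ (suc n) (b (suc n)) (β ⊛ w)) ⟩
      b (suc n) ∙ T n (shift (α ⊛ w)) + b (suc n) ∙ T (suc n) (β ⊛ w)
        ≈⟨ distribˡ (b (suc n)) _ _ ⟨
      b (suc n) ∙ (T n (shift (α ⊛ w)) + T (suc n) (β ⊛ w)) ∎

  -- A function u on the integers is determined by its values on [-2, 2] and by
  -- u(y) = - q^(y-2) u(y-5), in both directions; when u is 1 at c and 0
  -- elsewhere on [-2, 2], this gives u(5j+c) = (-1)^j q^e(j) with e(j) - e(j-1) = 5j - 2 + c,
  -- the exponents in Schur's finite forms of the Rogers-Ramanujan identities.
  -- Here u⁺ x = u(x), u⁻ x = u(-x) and U r s = u(s - r).
  module Schur (u₋₂ u₋₁ u₀ u₁ u₂ : Carrier) where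

    u⁺ u⁻ : ℕ → Carrier
    u⁺ 0 = u₀
    u⁺ 1 = u₁
    u⁺ 2 = u₂
    u⁺ 3 = - (q ^ᴿ 1 ∙ u₋₂)
    u⁺ 4 = - (q ^ᴿ 2 ∙ u₋₁)
    u⁺ (suc (suc (suc (suc (suc x))))) = - (q ^ᴿ (3 ℕ.+ x) ∙ u⁺ x)
    u⁻ 0 = u₀
    u⁻ 1 = u₋₁
    u⁻ 2 = u₋₂
    u⁻ 3 = - (q ^ᴿ 0 ∙ u₂)
    u⁻ 4 = - (q ^ᴿ 1 ∙ u₁)
    u⁻ (suc (suc (suc (suc (suc x))))) = - (q ^ᴿ (2 ℕ.+ x) ∙ u⁻ x)

    U : Weight
    U r       zero    = u⁻ r
    U zero    (suc s) = u⁺ (suc s)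
    U (suc r) (suc s) = U r s

    U-zeroˡ : ∀ s → U 0 s ≡ u⁺ s
    U-zeroˡ zero    = ≡.refl
    U-zeroˡ (suc s) = ≡.refl

    cancelʳ : ∀ x → x + 1# ∙ - x ≈ 0#
    cancelʳ x = trans (+-congˡ (*-identityˡ (- x))) (-‿inverseʳ x)

    cancelˡ : ∀ x → 1# ∙ - x + x ≈ 0#
    cancelˡ x = trans (+-comm _ x) (cancelʳ x)

    -- This is u(y) = - q^(y-2) u(y-5) at y = b + 2 - a, multiplied by q^a to avoid negative
    -- exponents. A diagonal step contributes a factor q; the base cases are the clauses of `u⁺` and
    -- `u⁻`.
    U-antiperiodic : ∀ a b → q ^ᴿ a ∙ U a (2 ℕ.+ b) + q ^ᴿ b ∙ U (3 ℕ.+ a) b ≈ 0#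
    U-antiperiodic (suc a) (suc b) = begin
      q ∙ q ^ᴿ a ∙ U a (2 ℕ.+ b) + q ∙ q ^ᴿ b ∙ U (3 ℕ.+ a) b
        ≈⟨ solve 5 (λ x A B u v → x :* A :* u :+ x :* B :* v := x :* (A :* u :+ B :* v)) refl
             q (q ^ᴿ a) (q ^ᴿ b) (U a (2 ℕ.+ b)) (U (3 ℕ.+ a) b) ⟩
      q ∙ (q ^ᴿ a ∙ U a (2 ℕ.+ b) + q ^ᴿ b ∙ U (3 ℕ.+ a) b)
        ≈⟨ *-congˡ (U-antiperiodic a b) ⟩
      q ∙ 0#  ≈⟨ zeroʳ q ⟩
      0#      ∎
    U-antiperiodic 0 0 = cancelʳ (1# ∙ u₂)
    U-antiperiodic 0 1 = cancelˡ (q ^ᴿ 1 ∙ u₋₂)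
    U-antiperiodic 0 2 = cancelˡ (q ^ᴿ 2 ∙ u₋₁)
    U-antiperiodic 0 (suc (suc (suc b))) rewrite U-zeroˡ b = cancelˡ (q ^ᴿ (3 ℕ.+ b) ∙ u⁺ b)
    U-antiperiodic 1 0 = cancelʳ (q ^ᴿ 1 ∙ u₁)
    U-antiperiodic (suc (suc a)) 0 = cancelʳ (q ^ᴿ (2 ℕ.+ a) ∙ u⁻ a)

    -‿*-zero : ∀ c {x} → x ≈ 0# → - (c ∙ x) ≈ 0#
    -‿*-zero c x≈0 = trans (-‿cong (trans (*-congˡ x≈0) (zeroʳ c))) -0#≈0#

    +5* : ∀ i k → i ℕ.+ suc k ℕ.* 5 ≡ 5 ℕ.+ i ℕ.+ k ℕ.* 5
    +5* i k = ≡.trans (≡.sym (ℕ.+-assoc i 5 (k ℕ.* 5))) (≡.cong (ℕ._+ k ℕ.* 5) (ℕ.+-comm i 5))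

    u⁺-zero : ∀ i k → u⁺ i ≈ 0# → u⁺ (i ℕ.+ k ℕ.* 5) ≈ 0#
    u⁺-zero i zero    z rewrite ℕ.+-identityʳ i = z
    u⁺-zero i (suc k) z rewrite +5* i k = u⁺-zero (5 ℕ.+ i) k (-‿*-zero (q ^ᴿ (3 ℕ.+ i)) z)

    u⁻-zero : ∀ i k → u⁻ i ≈ 0# → u⁻ (i ℕ.+ k ℕ.* 5) ≈ 0#
    u⁻-zero i zero    z rewrite ℕ.+-identityʳ i = z
    u⁻-zero i (suc k) z rewrite +5* i k = u⁻-zero (5 ℕ.+ i) k (-‿*-zero (q ^ᴿ (2 ℕ.+ i)) z)

    -- In terms of x = s - r these are u(x) + u(x-1) and u(x-2) + u(x+1).  For F the
    -- former meets the multiples of 5; passing to W moves the support off them.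
    V W : Weight
    V = U ⊕ shift U
    W r s = U (2 ℕ.+ r) s + U r (suc s)

    -- The q-Fibonacci recurrence for the weighted sums

    residue : Weight
    residue r s = q ^ᴿ r ∙ U r (2 ℕ.+ s) + q ^ᴿ s ∙ U (3 ℕ.+ r) s

    -- By `U-antiperiodic` the correction is zero everywhere; it absorbs the mismatch when two
    -- weights are compared below.
    T-residue : ∀ n w → T n (w ⊕ residue) ≈ T n w
    T-residue n w = T-cong n λ r s _ → trans (+-congˡ (U-antiperiodic r s)) (+-identityʳ (w r s))

    -- The two halves of `V` are expanded by different q-Pascal rules, which gives `V` and the
    -- leftovers `A` and `B`. Expanding each leftover by the rule not yet used on it gives q^(n+1)
    -- `V` plus `residue`, because `U` depends only on s - r.
    T-V-recurrence : ∀ n → T (2 ℕ.+ n) V ≈ T (1 ℕ.+ n) V + q ^ᴿ suc n ∙ T n V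
    T-V-recurrence n = begin
      T (2 ℕ.+ n) V
        ≈⟨ T-⊕ (2 ℕ.+ n) U (shift U) ⟩
      T (2 ℕ.+ n) U + T (2 ℕ.+ n) (shift U)
        ≈⟨ +-congˡ (T-pascal′ (1 ℕ.+ n) (shift U)) ⟩
      T (1 ℕ.+ n) (pascal U) + T (1 ℕ.+ n) (pascal′ (shift U))
        ≈⟨ T-⊕ (1 ℕ.+ n) (pascal U) (pascal′ (shift U)) ⟨
      T (1 ℕ.+ n) (pascal U ⊕ pascal′ (shift U))
        ≈⟨ T-cong (1 ℕ.+ n) (λ r s _ → solve 4 (λ a b c d →
             (a :+ b) :+ (c :+ d) := (d :+ a) :+ (b :+ c)) refl
             (U (suc r) s) (q ^ᴿ r ∙ U r (suc s)) (q ^ᴿ s ∙ U (2 ℕ.+ r) s) (U r s)) ⟩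
      T (1 ℕ.+ n) (V ⊕ (A ⊕ B))
        ≈⟨ trans (T-⊕ (1 ℕ.+ n) V (A ⊕ B)) (+-congˡ (T-⊕ (1 ℕ.+ n) A B)) ⟩
      T (1 ℕ.+ n) V + (T (1 ℕ.+ n) A + T (1 ℕ.+ n) B)
        ≈⟨ +-congˡ (+-congʳ (T-pascal′ n A)) ⟩
      T (1 ℕ.+ n) V + (T n (pascal′ A) + T n (pascal B))
        ≈⟨ +-congˡ (T-⊕ n _ _) ⟨
      T (1 ℕ.+ n) V + T n (pascal′ A ⊕ pascal B)
        ≈⟨ +-congˡ (T-cong n (λ r s _ → solve 7 (λ x Q P a b c d →
             (P :* (x :* Q :* a) :+ Q :* b) :+ (P :* c :+ Q :* (x :* P :* d))
             := x :* (Q :* P) :* (a :+ d) :+ (Q :* b :+ P :* c)) refl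
             q (q ^ᴿ r) (q ^ᴿ s) (U r s) (U r (2 ℕ.+ s)) (U (3 ℕ.+ r) s) (U (suc r) s))) ⟩
      T (1 ℕ.+ n) V + T n ((λ r s → q ∙ (q ^ᴿ r ∙ q ^ᴿ s) ∙ V r s) ⊕ residue)
        ≈⟨ +-congˡ (T-residue n _) ⟩
      T (1 ℕ.+ n) V + T n (λ r s → q ∙ (q ^ᴿ r ∙ q ^ᴿ s) ∙ V r s)
        ≈⟨ +-congˡ (T-cong n (λ r s r+s≡n → *-congʳ (*-congˡ
             (trans (sym (^-homo-* q r s)) (^-congʳ q r+s≡n))))) ⟩
      T (1 ℕ.+ n) V + T n (q ^ᴿ suc n ⊙ V)
        ≈⟨ +-congˡ (T-⊙ n (q ^ᴿ suc n) V) ⟩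
      T (1 ℕ.+ n) V + q ^ᴿ suc n ∙ T n V ∎
      where
      A B : Weight
      A r s = q ^ᴿ r ∙ U r (suc s)
      B r s = q ^ᴿ s ∙ U (2 ℕ.+ r) s

    -- One q-Pascal expansion, by a different rule on each half of `W`, yields `V` plus `residue`.
    -- For F this raises the size of the sum to the index of F, the number that 5 divides.
    T-W≈T-V : ∀ n → T (suc n) W ≈ T n V
    T-W≈T-V n = begin
      T (suc n) W
        ≈⟨ T-⊕ (suc n) W₁ W₂ ⟩
      T (suc n) W₁ + T (suc n) W₂
        ≈⟨ +-congʳ (T-pascal′ n W₁) ⟩
      T n (pascal′ W₁) + T n (pascal W₂)
        ≈⟨ T-⊕ n _ _ ⟨
      T n (pascal′ W₁ ⊕ pascal W₂)
        ≈⟨ T-cong n (λ r s _ → solve 4 (λ a b c d →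
             (a :+ b) :+ (c :+ d) := (c :+ b) :+ (d :+ a)) refl
             (q ^ᴿ s ∙ U (3 ℕ.+ r) s) (U (suc r) s) (U r s) (q ^ᴿ r ∙ U r (2 ℕ.+ s))) ⟩
      T n (V ⊕ residue)
        ≈⟨ T-residue n V ⟩
      T n V ∎
      where
      W₁ W₂ : Weight
      W₁ r s = U (2 ℕ.+ r) s
      W₂ r s = U r (suc s)

-- The q-Fibonacci recurrence for the defining sums

module Carlitz (R : CommutativeRing 0ℓ 0ℓ) (q : CommutativeRing.Carrier R) where

  open CommutativeRing R renaming (_*_ to _∙_)
  open import Algebra.Definitions.RawSemiring (Semiring.rawSemiring semiring) using () renaming (_^_ to _^ᴿ_)
  open import Algebra.Properties.Monoid.Sum +-monoid using (sum-syntax)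
  open import Algebra.Properties.Semiring.Exp semiring using (^-congʳ; ^-homo-*)
  open import Algebra.Solver.Ring.NaturalCoefficients.Default commutativeSemiring
  open import Relation.Binary.Reasoning.Setoid setoid

  recurrence-unique : ∀ {X Y c : ℕ → Carrier} →
    (∀ n → X (2 ℕ.+ n) ≈ X (1 ℕ.+ n) + c n ∙ X n) →
    (∀ n → Y (2 ℕ.+ n) ≈ Y (1 ℕ.+ n) + c n ∙ Y n) →
    X 0 ≈ Y 0 → X 1 ≈ Y 1 → ∀ n → X n ≈ Y n
  recurrence-unique rX rY e₀ e₁ zero          = e₀
  recurrence-unique rX rY e₀ e₁ (suc zero)    = e₁
  recurrence-unique rX rY e₀ e₁ (suc (suc n)) = trans (rX n) (trans
    (+-cong (recurrence-unique rX rY e₀ e₁ (suc n)) (*-congˡ (recurrence-unique rX rY e₀ e₁ n)))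
    (sym (rY n)))

  Σ< : ℕ → (ℕ → Carrier) → Carrier
  Σ< n f = ∑[ k < n ] f (toℕ k)

  Σ<-linear : ∀ n {f g h : ℕ → Carrier} {c} → (∀ k → k ℕ.< n → f k ≈ g k + c ∙ h k) →
    Σ< n f ≈ Σ< n g + c ∙ Σ< n h
  Σ<-linear zero    {c = c} eq = sym (trans (+-identityˡ _) (zeroʳ c))
  Σ<-linear (suc n) {f} {g} {h} {c} eq = begin
    f 0 + Σ< n (λ k → f (suc k))
      ≈⟨ +-cong (eq 0 (s≤s z≤n)) (Σ<-linear n (λ k k<n → eq (suc k) (s≤s k<n))) ⟩
    (g 0 + c ∙ h 0) + (Σ< n (λ k → g (suc k)) + c ∙ Σ< n (λ k → h (suc k)))
      ≈⟨ solve 5 (λ a c b x y → (a :+ c :* b) :+ (x :+ c :* y) := (a :+ x) :+ c :* (b :+ y)) refl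
           (g 0) c (h 0) (Σ< n (λ k → g (suc k))) (Σ< n (λ k → h (suc k))) ⟩
    (g 0 + Σ< n (λ k → g (suc k))) + c ∙ (h 0 + Σ< n (λ k → h (suc k))) ∎

  Σ<-extend : ∀ {m n} {f : ℕ → Carrier} → m ℕ.≤ n → (∀ k → m ℕ.≤ k → f k ≈ 0#) →
    Σ< m f ≈ Σ< n f
  Σ<-extend {n = zero}  z≤n       f≈0 = refl
  Σ<-extend {n = suc n} z≤n       f≈0 = trans (sym (+-identityˡ 0#))
    (+-cong (sym (f≈0 0 z≤n)) (Σ<-extend {n = n} z≤n (λ k _ → f≈0 (suc k) z≤n)))
  Σ<-extend             (s≤s m≤n) f≈0 = +-congˡ (Σ<-extend m≤n (λ k m≤k → f≈0 (suc k) (s≤s m≤k)))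

  module Gaussian
    (C : ℕ → ℕ → Carrier)
    (C-1 : ∀ n → C n 0 ≈ 1#)
    (C-0 : ∀ {n k} → n ℕ.< k → C n k ≈ 0#)
    (C-pascal : ∀ n k → C (suc n) (suc k) ≈ C n k + q ^ᴿ suc k ∙ C n (suc k))
    where

    -- The first rule expands both sides, and induction on `n` matches the results. The exponent n -
    -- r is carried as `s` to avoid subtraction.
    C-pascal′ : ∀ n r s → r ℕ.+ s ≡ n → C (suc n) (suc r) ≈ C n (suc r) + q ^ᴿ s ∙ C n r
    C-pascal′ n r zero r+0≡n = begin
      C (suc n) (suc r)              ≈⟨ C-pascal n r ⟩
      C n r + q ^ᴿ suc r ∙ C n (suc r) ≈⟨ +-congˡ (trans (*-congˡ z) (zeroʳ (q ^ᴿ suc r))) ⟩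
      C n r + 0#                     ≈⟨ solve 1 (λ a → a :+ con 0 := con 0 :+ con 1 :* a) refl (C n r) ⟩
      0# + 1# ∙ C n r                ≈⟨ +-congʳ z ⟨
      C n (suc r) + 1# ∙ C n r       ∎
      where
      z : C n (suc r) ≈ 0#
      z = C-0 (s≤s (ℕ.≤-reflexive (≡.trans (≡.sym r+0≡n) (ℕ.+-identityʳ r))))
    C-pascal′ (suc n) zero (suc s) ≡.refl = begin
      C (2 ℕ.+ s) 1
        ≈⟨ C-pascal (suc s) 0 ⟩
      C (suc s) 0 + q ^ᴿ 1 ∙ C (suc s) 1
        ≈⟨ +-cong (trans (C-1 (suc s)) (sym (C-1 s))) (*-congˡ (C-pascal′ s 0 s ≡.refl)) ⟩
      C s 0 + q ^ᴿ 1 ∙ (C s 1 + q ^ᴿ s ∙ C s 0)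
        ≈⟨ solve 4 (λ x P a b →
             a :+ x :* con 1 :* (b :+ P :* a) := (a :+ x :* con 1 :* b) :+ x :* P :* a) refl
             q (q ^ᴿ s) (C s 0) (C s 1) ⟩
      (C s 0 + q ^ᴿ 1 ∙ C s 1) + q ^ᴿ suc s ∙ C s 0
        ≈⟨ +-cong (C-pascal s 0) (*-congˡ (trans (C-1 (suc s)) (sym (C-1 s)))) ⟨
      C (suc s) 1 + q ^ᴿ suc s ∙ C (suc s) 0 ∎
    C-pascal′ (suc n) (suc r) (suc s) r+s≡n = begin
      C (2 ℕ.+ n) (2 ℕ.+ r)
        ≈⟨ C-pascal (suc n) (suc r) ⟩
      C (suc n) (suc r) + q ^ᴿ (2 ℕ.+ r) ∙ C (suc n) (2 ℕ.+ r)
        ≈⟨ +-cong (C-pascal′ n r (suc s) eq)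
               (*-congˡ (C-pascal′ n (suc r) s (≡.trans (≡.sym (ℕ.+-suc r s)) eq))) ⟩
      (C n (suc r) + q ^ᴿ suc s ∙ C n r) + q ^ᴿ (2 ℕ.+ r) ∙ (C n (2 ℕ.+ r) + q ^ᴿ s ∙ C n (suc r))
        ≈⟨ solve 6 (λ x Q P a b c →
             (b :+ x :* P :* a) :+ x :* (x :* Q) :* (c :+ P :* b)
             := (b :+ x :* (x :* Q) :* c) :+ x :* P :* (a :+ x :* Q :* b)) refl
             q (q ^ᴿ r) (q ^ᴿ s) (C n r) (C n (suc r)) (C n (2 ℕ.+ r)) ⟩
      (C n (suc r) + q ^ᴿ (2 ℕ.+ r) ∙ C n (2 ℕ.+ r)) + q ^ᴿ suc s ∙ (C n r + q ^ᴿ suc r ∙ C n (suc r))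
        ≈⟨ +-cong (C-pascal n (suc r)) (*-congˡ (C-pascal n r)) ⟨
      C (suc n) (2 ℕ.+ r) + q ^ᴿ suc s ∙ C (suc n) (suc r) ∎
      where
      eq : r ℕ.+ suc s ≡ n
      eq = ℕ.suc-injective r+s≡n

    -- These equations force e(k) = k^2 + (c-1)k, so c = 1 treats F and c = 2 treats G.
    module _ (c : ℕ) (e : ℕ → ℕ) (e₀ : e 0 ≡ 0)
             (eₛ : ∀ k → e (suc k) ≡ c ℕ.+ (k ℕ.+ k) ℕ.+ e k) where

      term : ℕ → ℕ → Carrier
      term n k = q ^ᴿ e k ∙ C (n ∸ k) k

      -- Indexed so that H n corresponds to F (suc n) or G (suc n).
      H : ℕ → Carrier
      H n = Σ< ⌈ suc n /2⌉ (term n)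

      term-0 : ∀ n → term n 0 ≈ 1#
      term-0 n rewrite e₀ = trans (*-identityˡ _) (C-1 n)

      H-0 : H 0 ≈ 1#
      H-0 = trans (+-identityʳ _) (term-0 0)

      H-1 : H 1 ≈ 1#
      H-1 = trans (+-identityʳ _) (term-0 1)

      term-vanish : ∀ n k → ⌈ suc n /2⌉ ℕ.≤ k → term n k ≈ 0#
      term-vanish n zero    ()
      term-vanish n (suc k) h≤k = trans (*-congˡ (C-0 (ℕ.m<n+o⇒m∸n<o n (suc k) n<2k))) (zeroʳ _)
        where
        n<2k : suc n ℕ.≤ suc k ℕ.+ suc k
        n<2k = ≡.subst (ℕ._≤ suc k ℕ.+ suc k) (ℕ.⌊n/2⌋+⌈n/2⌉≡n (suc n))
          (ℕ.+-mono-≤ (ℕ.≤-trans (ℕ.⌊n/2⌋≤⌈n/2⌉ (suc n)) h≤k) h≤k)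

      -- The second q-Pascal rule contributes q^(n-2k), and e(k+1) + (n-2k) = (c+n) + e(k), so the
      -- extra factor q^(c+n) is the same for every `k`.
      term-recurrence : ∀ n k → k ℕ.≤ ⌊ n /2⌋ →
        term (2 ℕ.+ n) (suc k) ≈ term (1 ℕ.+ n) (suc k) + q ^ᴿ (c ℕ.+ n) ∙ term n k
      term-recurrence n k k≤n/2 = begin
        q ^ᴿ e (suc k) ∙ C (suc n ∸ k) (suc k)
          ≡⟨ ≡.cong (λ j → q ^ᴿ e (suc k) ∙ C j (suc k)) (ℕ.+-∸-assoc 1 k≤n) ⟩
        q ^ᴿ e (suc k) ∙ C (suc (n ∸ k)) (suc k)
          ≈⟨ *-congˡ (C-pascal′ (n ∸ k) k s k+s≡n-k) ⟩
        q ^ᴿ e (suc k) ∙ (C (n ∸ k) (suc k) + q ^ᴿ s ∙ C (n ∸ k) k)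
          ≈⟨ distribˡ _ _ _ ⟩
        term (1 ℕ.+ n) (suc k) + q ^ᴿ e (suc k) ∙ (q ^ᴿ s ∙ C (n ∸ k) k)
          ≈⟨ +-congˡ (sym (*-assoc _ _ _)) ⟩
        term (1 ℕ.+ n) (suc k) + q ^ᴿ e (suc k) ∙ q ^ᴿ s ∙ C (n ∸ k) k
          ≈⟨ +-congˡ (*-congʳ exponents) ⟩
        term (1 ℕ.+ n) (suc k) + q ^ᴿ (c ℕ.+ n) ∙ q ^ᴿ e k ∙ C (n ∸ k) k
          ≈⟨ +-congˡ (*-assoc _ _ _) ⟩
        term (1 ℕ.+ n) (suc k) + q ^ᴿ (c ℕ.+ n) ∙ term n k ∎
        where
        s : ℕ
        s = n ∸ k ∸ k
        2k≤n : k ℕ.+ k ℕ.≤ n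
        2k≤n = ≡.subst (k ℕ.+ k ℕ.≤_) (ℕ.⌊n/2⌋+⌈n/2⌉≡n n)
          (ℕ.+-mono-≤ k≤n/2 (ℕ.≤-trans k≤n/2 (ℕ.⌊n/2⌋≤⌈n/2⌉ n)))
        k≤n : k ℕ.≤ n
        k≤n = ℕ.m+n≤o⇒m≤o k 2k≤n
        k+s≡n-k : k ℕ.+ s ≡ n ∸ k
        k+s≡n-k = ℕ.m+[n∸m]≡n (ℕ.m+n≤o⇒m≤o∸n k 2k≤n)
        n≡2k+s : n ≡ k ℕ.+ k ℕ.+ s
        n≡2k+s = ≡.trans (≡.sym (ℕ.m+[n∸m]≡n k≤n))
          (≡.trans (≡.cong (k ℕ.+_) (≡.sym k+s≡n-k)) (≡.sym (ℕ.+-assoc k k s)))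
        e+s≡c+n+e : e (suc k) ℕ.+ s ≡ c ℕ.+ n ℕ.+ e k
        e+s≡c+n+e rewrite eₛ k = ≡.trans
          (ℕS.solve 4 (λ c 2k e s → c ℕS.:+ 2k ℕS.:+ e ℕS.:+ s ℕS.:= c ℕS.:+ (2k ℕS.:+ s) ℕS.:+ e)
            ≡.refl c (k ℕ.+ k) (e k) s)
          (≡.cong (λ j → c ℕ.+ j ℕ.+ e k) (≡.sym n≡2k+s))
        exponents : q ^ᴿ e (suc k) ∙ q ^ᴿ s ≈ q ^ᴿ (c ℕ.+ n) ∙ q ^ᴿ e k
        exponents = trans (sym (^-homo-* q (e (suc k)) s))
          (trans (^-congʳ q e+s≡c+n+e) (^-homo-* q (c ℕ.+ n) (e k)))

      H-recurrence : ∀ n → H (2 ℕ.+ n) ≈ H (1 ℕ.+ n) + q ^ᴿ (c ℕ.+ n) ∙ H n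
      H-recurrence n = begin
        term (2 ℕ.+ n) 0 + Σ< h (λ k → term (2 ℕ.+ n) (suc k))
          ≈⟨ +-cong (trans (term-0 (2 ℕ.+ n)) (sym (term-0 (1 ℕ.+ n))))
               (Σ<-linear h {h = term n} λ k k<h → term-recurrence n k (ℕ.≤-pred k<h)) ⟩
        term (1 ℕ.+ n) 0 + (Σ< h (λ k → term (1 ℕ.+ n) (suc k)) + q ^ᴿ (c ℕ.+ n) ∙ H n)
          ≈⟨ +-assoc _ _ _ ⟨
        Σ< (suc h) (term (1 ℕ.+ n)) + q ^ᴿ (c ℕ.+ n) ∙ H n
          -- The range of `H (1 + n)` may stop one short of `suc h`; the term added there is zero.
          ≈⟨ +-congʳ (Σ<-extend (ℕ.⌈n/2⌉-mono (ℕ.n≤1+n (2 ℕ.+ n))) (term-vanish (1 ℕ.+ n))) ⟨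
        H (1 ℕ.+ n) + q ^ᴿ (c ℕ.+ n) ∙ H n ∎
        where
        h : ℕ
        h = ⌈ suc n /2⌉

-- Rearrangement and cancellation in commutative rings

module RingLemmas (R : CommutativeRing 0ℓ 0ℓ) where
  open CommutativeRing R renaming (_*_ to _∙_)
  open import Algebra.Properties.Ring ring using (-‿distribˡ-*; x∙y⁻¹≈ε⇒x≈y)
  open import Algebra.Solver.Ring.NaturalCoefficients.Default commutativeSemiring
  open import Relation.Binary.Reasoning.Setoid setoid

  move-summand : ∀ {x y r z} → x + y ∙ r ≈ z → x ≈ - y ∙ r + z
  move-summand {x} {y} {r} {z} eq = begin
    x                          ≈⟨ +-identityˡ x ⟨
    0# + x                     ≈⟨ +-congʳ (-‿inverseˡ (y ∙ r)) ⟨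
    - (y ∙ r) + y ∙ r + x      ≈⟨ +-cong (+-congʳ (-‿distribˡ-* y r)) refl ⟩
    - y ∙ r + y ∙ r + x        ≈⟨ solve 3 (λ a b x → a :+ b :+ x := a :+ (x :+ b)) refl (- y ∙ r) (y ∙ r) x ⟩
    - y ∙ r + (x + y ∙ r)      ≈⟨ +-congˡ eq ⟩
    - y ∙ r + z                ∎

  collect : ∀ x a b → b + x ∙ (a ∙ b) ≈ (1# + x ∙ a) ∙ b
  collect = solve 3 (λ x a b → b :+ x :* (a :* b) := (con 1 :+ x :* a) :* b) refl

  rearrange : ∀ {c t n y d} → c ∙ t ≈ n ∙ y → n ≈ d ∙ c → t ∙ c ≈ (y ∙ d) ∙ c
  rearrange {c} {t} {n} {y} {d} ct≈ny n≈dc = begin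
    t ∙ c         ≈⟨ *-comm t c ⟩
    c ∙ t         ≈⟨ ct≈ny ⟩
    n ∙ y         ≈⟨ *-congʳ n≈dc ⟩
    (d ∙ c) ∙ y   ≈⟨ solve 3 (λ d c y → d :* c :* y := y :* d :* c) refl d c y ⟩
    (y ∙ d) ∙ c   ∎

  cancelʳ-by : ∀ c → (∀ x → x ∙ c ≈ 0# → x ≈ 0#) → ∀ {x y} → x ∙ c ≈ y ∙ c → x ≈ y
  cancelʳ-by c reg {x} {y} eq = x∙y⁻¹≈ε⇒x≈y x y (reg (x - y) (begin
    (x - y) ∙ c        ≈⟨ distribʳ c x (- y) ⟩
    x ∙ c + - y ∙ c    ≈⟨ +-cong eq (sym (-‿distribˡ-* y c)) ⟩
    y ∙ c - y ∙ c      ≈⟨ -‿inverseʳ (y ∙ c) ⟩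
    0#                 ∎))

-- Cancellation and q-integers in ℤ[q]

open RingLemmas ℤ[q]
open Weighted ℤ[q] q
open Carlitz ℤ[q] q
open import Algebra.Properties.Magma.Divisibility R.*-magma using (∣ʳ-respʳ-≈)

0·-+ₚ : ∀ p r i → coeff (0ℤ · p +ₚ r) i ≡ coeff r i
0·-+ₚ []      r       i       = ≡.refl
0·-+ₚ (a ∷ p) []      zero    = ≡.refl
0·-+ₚ (a ∷ p) (b ∷ r) zero    = ℤ.+-identityˡ b
0·-+ₚ (a ∷ p) (b ∷ r) (suc i) = 0·-+ₚ p r i
0·-+ₚ (a ∷ p) []      (suc i) = ≡.trans (≡.sym (plus-[] (0ℤ · p) i)) (0·-+ₚ p [] i)
  where
  plus-[] : ∀ p i → coeff (p +ₚ []) i ≡ coeff p i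
  plus-[] []      i = ≡.refl
  plus-[] (a ∷ p) i = ≡.refl

-- The product has constant term b a = b, so b = 0; what remains is q times the product with the
-- tail of `r`, and the argument repeats.
*ₚ-regular : ∀ p → coeff p 0 ≡ 1ℤ → ∀ r → r *ₚ p ≈ₚ 0ₚ → r ≈ₚ 0ₚ
*ₚ-regular (a ∷ p) a≡1 []      _  = R.refl
*ₚ-regular (a ∷ p) a≡1 (b ∷ r) rp≈0 = coeffs λ
  { zero    → b≡0
  ; (suc i) → at (*ₚ-regular (a ∷ p) a≡1 r (coeffs tail)) i }
  where
  b≡0 : b ≡ 0ℤ
  b≡0 = ≡.trans (≡.sym (≡.trans (ℤ.+-identityʳ (b ℤ.* a))
    (≡.trans (≡.cong (b ℤ.*_) a≡1) (ℤ.*-identityʳ b)))) (at rp≈0 0)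
  tail : ∀ i → coeff (r *ₚ (a ∷ p)) i ≡ 0ℤ
  tail i = ≡.trans (≡.sym (0·-+ₚ (a ∷ p) (0ℤ ∷ r *ₚ (a ∷ p)) (suc i)))
    (≡.subst (λ c → coeff (c · (a ∷ p) +ₚ (0ℤ ∷ r *ₚ (a ∷ p))) (suc i) ≡ 0ℤ) b≡0 (at rp≈0 (suc i)))

coeff₀-[suc] : ∀ n → coeff [ suc n ]⟨ q ⟩ 0 ≡ 1ℤ
coeff₀-[suc] n = ≡.trans (at ([suc] n q) 0) (1+q* [ n ]⟨ q ⟩)
  where
  1+q* : ∀ p → coeff (1ₚ +ₚ q *ₚ p) 0 ≡ 1ℤ
  1+q* []      = ≡.refl
  1+q* (a ∷ p) = ≡.refl

-- The a b powers of x fall into a blocks of length b, each x^b times the one before.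
[*] : ∀ a b x → [ a * b ]⟨ x ⟩ ≈ₚ [ a ]⟨ x ^ₚ b ⟩ *ₚ [ b ]⟨ x ⟩
[*] zero    b x = R.refl
[*] (suc a) b x = begin
  [ b ℕ.+ a * b ]⟨ x ⟩                    ≈⟨ [+] b (a * b) x ⟩
  B +ₚ x ^ₚ b *ₚ [ a * b ]⟨ x ⟩           ≈⟨ R.+-congˡ {B} (R.*-congˡ {x ^ₚ b} ([*] a b x)) ⟩
  B +ₚ x ^ₚ b *ₚ ([ a ]⟨ x ^ₚ b ⟩ *ₚ B)   ≈⟨ collect (x ^ₚ b) [ a ]⟨ x ^ₚ b ⟩ B ⟩
  (1ₚ +ₚ x ^ₚ b *ₚ [ a ]⟨ x ^ₚ b ⟩) *ₚ B  ≈⟨ R.*-congʳ {B} ([suc] a (x ^ₚ b)) ⟨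
  [ suc a ]⟨ x ^ₚ b ⟩ *ₚ B                ∎
  where
  open import Relation.Binary.Reasoning.Setoid R.setoid
  B = [ b ]⟨ x ⟩

-- Lifts an identity of natural numbers to q-integers: [m + cr] = [m] + q^m [cr], while [cr] and
-- [dn] are multiples of [r] and [n].
[]-combination : ∀ {m n r} c d → m ℕ.+ c * r ≡ d * n →
  ∃₂ λ α β → [ m ]⟨ q ⟩ ≈ₚ α *ₚ [ r ]⟨ q ⟩ +ₚ β *ₚ [ n ]⟨ q ⟩
[]-combination {m} {n} {r} c d eq = -ₚ Y , Z , move-summand {y = Y} {r = [ r ]⟨ q ⟩} (begin
  [ m ]⟨ q ⟩ +ₚ Y *ₚ [ r ]⟨ q ⟩
    ≈⟨ R.+-congˡ {[ m ]⟨ q ⟩} (R.*-assoc (q ^ₚ m) [ c ]⟨ q ^ₚ r ⟩ [ r ]⟨ q ⟩) ⟩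
  [ m ]⟨ q ⟩ +ₚ q ^ₚ m *ₚ ([ c ]⟨ q ^ₚ r ⟩ *ₚ [ r ]⟨ q ⟩)
    ≈⟨ R.+-congˡ {[ m ]⟨ q ⟩} (R.*-congˡ {q ^ₚ m} ([*] c r q)) ⟨
  [ m ]⟨ q ⟩ +ₚ q ^ₚ m *ₚ [ c * r ]⟨ q ⟩
    ≈⟨ [+] m (c * r) q ⟨
  [ m ℕ.+ c * r ]⟨ q ⟩
    ≡⟨ ≡.cong [_]⟨ q ⟩ eq ⟩
  [ d * n ]⟨ q ⟩
    ≈⟨ [*] d n q ⟩
  Z *ₚ [ n ]⟨ q ⟩ ∎)
  where
  open import Relation.Binary.Reasoning.Setoid R.setoid
  Y Z : Poly
  Y = q ^ₚ m *ₚ [ c ]⟨ q ^ₚ r ⟩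
  Z = [ d ]⟨ q ^ₚ n ⟩

-- Bézout's identity for q-integers

coprime-* : ∀ {a b r} → Coprime a r → Coprime b r → Coprime (a * b) r
coprime-* a⊥r b⊥r (d∣ab , d∣r) =
  b⊥r (coprime-divisor (λ (e∣d , e∣a) → a⊥r (e∣a , ∣-trans e∣d d∣r)) d∣ab , d∣r)

coprime-^ : ∀ {a r} k → Coprime a r → Coprime (a ^ k) r
coprime-^ {r = r} zero    _   = 1-coprimeTo r
coprime-^         (suc k) a⊥r = coprime-* a⊥r (coprime-^ k a⊥r)

prime∤⇒coprime : ∀ {p r} → Prime p → ¬ (p ∣ℕ r) → Coprime p r
prime∤⇒coprime pr p∤r (d∣p , d∣r) with prime⇒irreducible pr d∣p
... | inj₁ d≡1    = d≡1
... | inj₂ ≡.refl = contradiction d∣r p∤r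

-- A Bézout identity between `a` and `r`, scaled by `m`, has the form that `[]-combination` takes;
-- its sign decides which of r and a m is subtracted.
[]-bézout : ∀ {a r} m → Coprime a r →
  ∃₂ λ α β → [ m ]⟨ q ⟩ ≈ₚ α *ₚ [ r ]⟨ q ⟩ +ₚ β *ₚ [ a * m ]⟨ q ⟩
[]-bézout {a} {r} m a⊥r with coprime-Bézout a⊥r
... | Bézout.+- x y eq = []-combination (m * y) x (begin
  m ℕ.+ m * y * r      ≡⟨ solve 3 (λ m y r → m :+ m :* y :* r := (con 1 :+ y :* r) :* m) ≡.refl m y r ⟩
  (1 ℕ.+ y * r) * m    ≡⟨ ≡.cong (_* m) eq ⟩
  x * a * m            ≡⟨ ℕ.*-assoc x a m ⟩
  x * (a * m)          ∎)
  where
  open ≡.≡-Reasoning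
  open +-*-Solver
-- Here r and a m exchange roles, so the two coefficients come out in the opposite order.
... | Bézout.-+ x y eq with []-combination {m} {r} {a * m} x (m * y) (begin
  m ℕ.+ x * (a * m)    ≡⟨ solve 3 (λ m x a → m :+ x :* (a :* m) := m :* (con 1 :+ x :* a)) ≡.refl m x a ⟩
  m * (1 ℕ.+ x * a)    ≡⟨ ≡.cong (m *_) eq ⟩
  m * (y * r)          ≡⟨ ℕ.*-assoc m y r ⟨
  m * y * r            ∎)
  where
  open ≡.≡-Reasoning
  open +-*-Solver
...   | α , β , e = β , α , R.trans e (R.+-comm (α *ₚ [ a * m ]⟨ q ⟩) (β *ₚ [ r ]⟨ q ⟩))

-- Divisibility of the weighted sums

divides-T : ∀ p → Prime p → ∀ k m n w → suc n ≡ p ^ suc k * m →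
  (∀ a b → w (a * p) (b * p) ≈ₚ 0ₚ) → [ p ^ suc k ]⟨ q ^ₚ m ⟩ ∣ T (suc n) w
divides-T p pr k zero    n w eq w≈0 = contradiction (≡.trans eq (ℕ.*-zeroʳ (p ^ suc k))) λ ()
divides-T p pr k (suc m) n w eq w≈0 = record
  { quotient = Y
  ; equality = R.sym (cancelʳ-by M (*ₚ-regular M (coeff₀-[suc] m))
      (rearrange {M} {T (suc n) w} {N} {Y} {D} identity N≈DM)) }
  where
  D M N : Poly
  D = [ p ^ suc k ]⟨ q ^ₚ suc m ⟩
  M = [ suc m ]⟨ q ⟩
  N = [ suc n ]⟨ q ⟩
  N≈DM : N ≈ₚ D *ₚ M
  N≈DM = R.trans (R.reflexive (≡.cong [_]⟨ q ⟩ eq)) ([*] (p ^ suc k) (suc m) q)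
  coefficients : ∀ r → ∃₂ λ α β → (p ∣ℕ r) ⊎ (M ≈ₚ α *ₚ [ r ]⟨ q ⟩ +ₚ β *ₚ N)
  coefficients r with p ∣? r
  -- The default 0 makes the coefficients total functions of `r`; at such `r` the weight vanishes.
  ... | yes p∣r = 0ₚ , 0ₚ , inj₁ p∣r
  ... | no  p∤r with []-bézout (suc m) (coprime-^ (suc k) (prime∤⇒coprime pr p∤r))
  ...   | α , β , e = α , β , inj₂
    (≡.subst (λ j → M ≈ₚ α *ₚ [ r ]⟨ q ⟩ +ₚ β *ₚ [ j ]⟨ q ⟩) (≡.sym eq) e)
  α β : ℕ → Poly
  α r = proj₁ (coefficients r)
  β r = proj₁ (proj₂ (coefficients r))
  p∣n : p ∣ℕ suc n
  p∣n = ≡.subst (p ∣ℕ_) (≡.sym eq) (∣-trans (m∣m*n (p ^ k)) (m∣m*n (suc m)))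
  vanish : ∀ r s → r ℕ.+ s ≡ suc n → p ∣ℕ r → w r s ≈ₚ 0ₚ
  -- As p divides both r and r + s, it divides s, so the hypothesis on `w` applies.
  vanish r s r+s≡n p∣r with p∣r | ∣m+n∣m⇒∣n (≡.subst (p ∣ℕ_) (≡.sym r+s≡n) p∣n) p∣r
  ... | divides a ≡.refl | divides b ≡.refl = w≈0 a b
  termwise : ∀ r s → r ℕ.+ s ≡ suc n → M *ₚ w r s ≈ₚ (α r *ₚ [ r ]⟨ q ⟩ +ₚ β r *ₚ N) *ₚ w r s
  termwise r s r+s≡n with proj₂ (proj₂ (coefficients r))
  ... | inj₁ p∣r = R.trans (both M) (R.sym (both (α r *ₚ [ r ]⟨ q ⟩ +ₚ β r *ₚ N)))
    where
    both : ∀ x → x *ₚ w r s ≈ₚ 0ₚ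
    both x = R.trans (R.*-congˡ {x} (vanish r s r+s≡n p∣r)) (R.zeroʳ x)
  ... | inj₂ e = R.*-congʳ {w r s} e
  Y : Poly
  Y = T n (shift (α ⊛ w)) +ₚ T (suc n) (β ⊛ w)
  identity : M *ₚ T (suc n) w ≈ₚ N *ₚ Y
  identity = T-divisible [_]⟨ q ⟩ R.refl (λ n → [suc] n q) n M w α β termwise

-- Gaussian binomials as exact quotients

qbinomial-vanish : ∀ {n k} → n ℕ.< k → qbinomial n k ≡ 0ₚ
qbinomial-vanish {zero}  {suc k} _ = ≡.refl
qbinomial-vanish {suc n} {suc k} (s≤s n<k) with k ℕ.≤? n
... | yes k≤n = contradiction k≤n (ℕ.<⇒≱ n<k)
... | no  _   = ≡.refl

qbinomial-zeroʳ : ∀ n → qbinomial n 0 ≡ 1ₚ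
qbinomial-zeroʳ zero    = ≡.refl
qbinomial-zeroʳ (suc n) = ≡.refl

-- For k ≤ n the quotient was constructed by this very recursion; for k > n all three binomials are
-- zero.
qbinomial-pascal : ∀ n k →
  qbinomial (suc n) (suc k) ≈ₚ qbinomial n k +ₚ q ^ₚ suc k *ₚ qbinomial n (suc k)
qbinomial-pascal n k with k ℕ.≤? n
... | yes _   = R.refl
... | no  k≰n
  rewrite qbinomial-vanish (ℕ.≰⇒> k≰n) | qbinomial-vanish (ℕ.m<n⇒m<1+n (ℕ.≰⇒> k≰n)) =
  R.sym (R.zeroʳ (q ^ₚ suc k))

-- The q-Fibonacci numbers as weighted sums

open Gaussian qbinomial
  (λ n → R.reflexive (qbinomial-zeroʳ n))
  (λ n<k → R.reflexive (qbinomial-vanish n<k))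
  qbinomial-pascal

-- The function u is supported on 5ℤ for F and on 5ℤ - 2 for G.
module SF = Schur 0ₚ 0ₚ 1ₚ 0ₚ 0ₚ
module SG = Schur 1ₚ 0ₚ 0ₚ 0ₚ 0ₚ

-- The recurrence identifies F(n+1) with the sum of `V` of size n; passing to `W` corrects the size
-- to n+1.
F≈T : ∀ n → F (suc n) ≈ₚ T (suc n) SF.W
F≈T n = R.trans (recurrence-unique {c = λ n → q ^ₚ suc n}
    (H-recurrence 1 e ≡.refl eₛ) SF.T-V-recurrence
    (H-0 1 e ≡.refl eₛ) (H-1 1 e ≡.refl eₛ) n)
  (R.sym (SF.T-W≈T-V n))
  where
  e : ℕ → ℕ
  e k = k * k
  eₛ : ∀ k → e (suc k) ≡ 1 ℕ.+ (k ℕ.+ k) ℕ.+ e k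
  eₛ = solve 1 (λ k → (con 1 :+ k) :* (con 1 :+ k) := con 1 :+ (k :+ k) :+ k :* k) ≡.refl
    where open +-*-Solver

-- The factor for G is q^(n+2), so the recurrence for `V` is used one step later and the sizes
-- already agree.
G≈T : ∀ n → G (suc n) ≈ₚ T (suc n) SG.V
G≈T = recurrence-unique {c = λ n → q ^ₚ (2 ℕ.+ n)}
    (H-recurrence 2 e ≡.refl eₛ) (λ n → SG.T-V-recurrence (suc n))
    (H-0 2 e ≡.refl eₛ) (R.trans (H-1 2 e ≡.refl eₛ) (R.sym T₂≈1))
  where
  T₂≈1 : T 2 SG.V ≈ₚ 1ₚ
  -- With this seed the sums of size 1 and 0 evaluate to 1 and 0.
  T₂≈1 = R.trans (SG.T-V-recurrence 0) (R.+-congˡ {1ₚ} (R.zeroʳ (q ^ₚ 1)))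
  e : ℕ → ℕ
  e k = k * k ℕ.+ k
  eₛ : ∀ k → e (suc k) ≡ 2 ℕ.+ (k ℕ.+ k) ℕ.+ e k
  eₛ = solve 1 (λ k →
      (con 1 :+ k) :* (con 1 :+ k) :+ (con 1 :+ k) := con 2 :+ (k :+ k) :+ (k :* k :+ k)) ≡.refl
    where open +-*-Solver

-- The two values of u are taken at arguments congruent to -2 and 1 modulo 5, off the support 5ℤ.
-- Common multiples of 5 cancel along the diagonal.
SF-W-vanish : ∀ a b → SF.W (a * 5) (b * 5) ≈ₚ 0ₚ
SF-W-vanish a b = R.+-cong (first a b) (second a b)
  where
  first : ∀ a b → SF.U (2 ℕ.+ a * 5) (b * 5) ≈ₚ 0ₚ
  first a       zero    = SF.u⁻-zero 2 a R.refl
  first zero    (suc b) = SF.u⁺-zero 3 b (SF.-‿*-zero (q ^ₚ 1) R.refl)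
  first (suc a) (suc b) = first a b
  second : ∀ a b → SF.U (a * 5) (1 ℕ.+ b * 5) ≈ₚ 0ₚ
  second zero    b       = SF.u⁺-zero 1 b R.refl
  second (suc a) zero    = SF.u⁻-zero 4 a (SF.-‿*-zero (q ^ₚ 1) R.refl)
  second (suc a) (suc b) = second a b

-- Here the arguments are congruent to 0 and -1 modulo 5, off the support 5ℤ - 2.
SG-V-vanish : ∀ a b → SG.V (a * 5) (b * 5) ≈ₚ 0ₚ
SG-V-vanish a b = R.+-cong (first a b) (second a b)
  where
  first : ∀ a b → SG.U (a * 5) (b * 5) ≈ₚ 0ₚ
  first a       zero    = SG.u⁻-zero 0 a R.refl
  first zero    (suc b) = SG.u⁺-zero 5 b (SG.-‿*-zero (q ^ₚ 3) {0ₚ} R.refl)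
  first (suc a) (suc b) = first a b
  second : ∀ a b → SG.U (1 ℕ.+ a * 5) (b * 5) ≈ₚ 0ₚ
  second a       zero    = SG.u⁻-zero 1 a R.refl
  second zero    (suc b) = SG.u⁺-zero 4 b (SG.-‿*-zero (q ^ₚ 2) R.refl)
  second (suc a) (suc b) = second a b

-- Conclusion for the prime 5

prime₅ : Prime 5
prime₅ = from-yes (prime? 5)

theorem2p1 : (k m : ℕ) → 1 ≤ k → 1 ≤ m → m % 5 ≢ 0 →
    ([ 5 ^ k ]⟨ q ^ₚ m ⟩ ∣ F (5 ^ k * m)) × ([ 5 ^ k ]⟨ q ^ₚ m ⟩ ∣ G (5 ^ k * m))
theorem2p1 (suc k) (suc m) _ _ _ =
  ≡.subst (λ j → ([ 5 ^ suc k ]⟨ q ^ₚ suc m ⟩ ∣ F j) × ([ 5 ^ suc k ]⟨ q ^ₚ suc m ⟩ ∣ G j)) n≡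
    ( ∣ʳ-respʳ-≈ (R.sym (F≈T n)) (divides-T 5 prime₅ k (suc m) n SF.W n≡ SF-W-vanish)
    , ∣ʳ-respʳ-≈ (R.sym (G≈T n)) (divides-T 5 prime₅ k (suc m) n SG.V n≡ SG-V-vanish))
  where
  n : ℕ
  n = ℕ.pred (5 ^ suc k * suc m)
  n≡ : suc n ≡ 5 ^ suc k * suc m
  n≡ = ℕ.suc-pred (5 ^ suc k * suc m) {{ℕ.m*n≢0 (5 ^ suc k) (suc m) {{ℕ.m^n≢0 5 (suc k)}}}}
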